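{- Given a $\texttt{b- }\Sigma_{2,\le}$-sentence $\exists X\in I^n.\forall Y\in I^m.\,\Phi_{0,\le}(X,Y)$, one can compute in polynomial time an equivalent $\Sigma_{2,\le}$-sentence.
   Context: $\mathcal L$ is the first-order language over the signature $\langle \mathbb Z,+,\times,<,\le\rangle$ with connectives $\land,\lor$ (negation, implication, equality as abbreviations), integer constants in binary, polynomials in atoms given as terms over $\langle\mathbb Z,+,\times\rangle$, interpreted over $\mathbb R$. A $\mathrm{QFF}_\le$-formula is a quantifier-free $\mathcal L$-formula not containing $<$. A $\Sigma_{2,\le}$-sentence is $\exists X\in\mathbb R^n.\forall Y\in\mathbb R^m.\Phi(X,Y)$ with $\Phi$ a $\mathrm{QFF}_\le$-formula. $I=[-1,1]$; $|X|\le y$ abbreviates $\bigwedge_j(-y\le x_j\le y)$ and $|X|>y$ its negation. A $\texttt{b- }\Sigma_{2,\le}$-sentence $\exists X\in I^n.\forall Y\in I^m.\Phi_{0,\le}(X,Y)$ (with $\Phi_{0,\le}$ a $\mathrm{QFF}_\le$-formula) abbreviates $\exists X\in\mathbb R^n.\forall Y\in\mathbb R^m.(|Y|>1\lor(|X|\le1\land\Phi_{0,\le}(X,Y)))$ (note this is not itself a $\Sigma_{2,\le}$-sentence since it contains strict inequalities). -}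

module Defs where

open import Algebra.Bundles using (CommutativeRing)
import Algebra.Definitions.RawMonoid as RawMonoidDefs
open import Data.Digit using (Bit; toDigits)
open import Data.Fin.Base using (Fin; zero; suc; toℕ)
open import Data.Integer.Base as ℤ using (ℤ; +_; -[1+_])
open import Data.List.Base using (List; []; _∷_; _++_; _ʳ++_; length; map; replicate)
open import Data.Maybe.Base using (Maybe; just; nothing)
open import Data.Nat.Base as ℕ using (ℕ; zero; suc)
open import Data.Product.Base using (Σ-syntax; ∃; ∃-syntax; _×_; _,_; proj₁)
open import Data.Sum.Base using (_⊎_; inj₁; inj₂; [_,_]′)
open import Data.Vec.Base as Vec using (Vec; []; _∷_)
open import Data.Vec.Functional as Vector using (Vector)
open import Function.Base using (_∘_)
open import Level using (0ℓ) renaming (suc to lsuc)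
open import Relation.Binary.Core using (Rel)
import Relation.Binary.Construct.StrictToNonStrict as StrictToNonStrict
open import Relation.Binary.PropositionalEquality.Core using (_≡_)
open import Relation.Binary.Structures using (IsStrictTotalOrder)
open import Relation.Nullary.Negation.Core using (¬_)

-- The real numbers, given by their characterisation up to isomorphism as
-- the complete ordered field.  The trichotomy in IsStrictTotalOrder is the
-- classical one.
record CompleteOrderedField : Set (lsuc 0ℓ) where
  field
    commutativeRing : CommutativeRing 0ℓ 0ℓ
  open CommutativeRing commutativeRing public

  infix 4 _<_
  field
    _<_                : Rel Carrier 0ℓ
    isStrictTotalOrder : IsStrictTotalOrder _≈_ _<_
  open StrictToNonStrict _≈_ _<_ public using (_≤_)

  field
    0<1      : 0# < 1#
    +-mono-< : ∀ {x y} z → x < y → (x + z) < (y + z)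
    *-pos    : ∀ {x y} → 0# < x → 0# < y → 0# < (x * y)
    inverse  : ∀ x → ¬ (x ≈ 0#) → ∃[ y ] (x * y) ≈ 1#

  UpperBound : (Carrier → Set) → Carrier → Set
  UpperBound P b = ∀ x → P x → x ≤ b

  field
    supremum : (P : Carrier → Set) → ∃ P → ∃ (UpperBound P) →
               ∃[ s ] UpperBound P s × (∀ b → UpperBound P b → s ≤ b)

  fromℤ : ℤ → Carrier
  fromℤ (+ n)    = RawMonoidDefs._×_ +-rawMonoid n 1#
  fromℤ -[1+ n ] = - RawMonoidDefs._×_ +-rawMonoid (suc n) 1#

infixl 7 _×ᵗ_
infixl 6 _+ᵗ_
infix  5 _<ᶠ_ _≤ᶠ_
infixr 4 _∧ᶠ_
infixr 3 _∨ᶠ_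

data Term (V : Set) : Set where
  const : ℤ → Term V
  var   : V → Term V
  _+ᵗ_  : Term V → Term V → Term V
  _×ᵗ_  : Term V → Term V → Term V

data QFF (V : Set) : Set where
  _<ᶠ_ : Term V → Term V → QFF V
  _≤ᶠ_ : Term V → Term V → QFF V
  _∧ᶠ_ : QFF V → QFF V → QFF V
  _∨ᶠ_ : QFF V → QFF V → QFF V

data StrictFree {V : Set} : QFF V → Set where
  ≤-free : ∀ s t → StrictFree (s ≤ᶠ t)
  ∧-free : ∀ {φ ψ} → StrictFree φ → StrictFree ψ → StrictFree (φ ∧ᶠ ψ)
  ∨-free : ∀ {φ ψ} → StrictFree φ → StrictFree ψ → StrictFree (φ ∨ᶠ ψ)

-- Negation is not a connective: it abbreviates its negation normal form.
¬ᶠ_ : ∀ {V} → QFF V → QFF V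
¬ᶠ (s <ᶠ t) = t ≤ᶠ s
¬ᶠ (s ≤ᶠ t) = t <ᶠ s
¬ᶠ (φ ∧ᶠ ψ) = (¬ᶠ φ) ∨ᶠ (¬ᶠ ψ)
¬ᶠ (φ ∨ᶠ ψ) = (¬ᶠ φ) ∧ᶠ (¬ᶠ ψ)

-ᵗ_ : ∀ {V} → Term V → Term V
-ᵗ t = const ℤ.-1ℤ ×ᵗ t

-- The language has no constant for truth, so the empty conjunction is 0 ≤ 0.
⋀ : ∀ {V k} → Vector (QFF V) k → QFF V
⋀ = Vector.foldr _∧ᶠ_ (const ℤ.0ℤ ≤ᶠ const ℤ.0ℤ)

∣_∣≤_ : ∀ {V k} → Vector V k → Term V → QFF V
∣ Z ∣≤ y = ⋀ λ j → ((-ᵗ y) ≤ᶠ var (Z j)) ∧ᶠ (var (Z j) ≤ᶠ y)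

∣_∣>_ : ∀ {V k} → Vector V k → Term V → QFF V
∣ Z ∣> y = ¬ᶠ (∣ Z ∣≤ y)

-- inj₁ i is the existential variable xᵢ, inj₂ j the universal variable yⱼ.
Var : ℕ → ℕ → Set
Var n m = Fin n ⊎ Fin m

-- ∃ X ∈ ℝⁿ. ∀ Y ∈ ℝᵐ. matrix
record Σ₂ : Set where
  constructor ∃∀
  field
    n m    : ℕ
    matrix : QFF (Var n m)

record Σ₂≤ : Set where
  field
    sentence   : Σ₂
    strictFree : StrictFree (Σ₂.matrix sentence)

-- ∃ X ∈ Iⁿ. ∀ Y ∈ Iᵐ. matrix, with I = [-1,1]
record bΣ₂≤ : Set where
  field
    n m        : ℕ
    matrix     : QFF (Var n m)
    strictFree : StrictFree matrix

-- The sentence over ℝ that a bounded sentence abbreviates.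
unabbreviate : bΣ₂≤ → Σ₂
unabbreviate s = ∃∀ n m ((∣ Y ∣> 1ᵗ) ∨ᶠ ((∣ X ∣≤ 1ᵗ) ∧ᶠ matrix))
  where
  open bΣ₂≤ s
  1ᵗ : Term (Var n m)
  1ᵗ = const ℤ.1ℤ
  X : Vector (Var n m) n
  X = inj₁
  Y : Vector (Var n m) m
  Y = inj₂

module Semantics (ℝ : CompleteOrderedField) where
  open CompleteOrderedField ℝ

  ⟦_⟧ᵗ : ∀ {V} → Term V → (V → Carrier) → Carrier
  ⟦ const c ⟧ᵗ ρ = fromℤ c
  ⟦ var v   ⟧ᵗ ρ = ρ v
  ⟦ s +ᵗ t  ⟧ᵗ ρ = ⟦ s ⟧ᵗ ρ + ⟦ t ⟧ᵗ ρ
  ⟦ s ×ᵗ t  ⟧ᵗ ρ = ⟦ s ⟧ᵗ ρ * ⟦ t ⟧ᵗ ρ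

  ⟦_⟧ᶠ : ∀ {V} → QFF V → (V → Carrier) → Set
  ⟦ s <ᶠ t ⟧ᶠ ρ = ⟦ s ⟧ᵗ ρ < ⟦ t ⟧ᵗ ρ
  ⟦ s ≤ᶠ t ⟧ᶠ ρ = ⟦ s ⟧ᵗ ρ ≤ ⟦ t ⟧ᵗ ρ
  ⟦ φ ∧ᶠ ψ ⟧ᶠ ρ = ⟦ φ ⟧ᶠ ρ × ⟦ ψ ⟧ᶠ ρ
  ⟦ φ ∨ᶠ ψ ⟧ᶠ ρ = ⟦ φ ⟧ᶠ ρ ⊎ ⟦ ψ ⟧ᶠ ρ

  True : Σ₂ → Set
  True (∃∀ n m Φ) =
    Σ[ X ∈ Vector Carrier n ] ((Y : Vector Carrier m) → ⟦ Φ ⟧ᶠ [ X , Y ]′)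

infix 2 _⊨_
_⊨_ : CompleteOrderedField → Σ₂ → Set
ℝ ⊨ σ = Semantics.True ℝ σ

-- Sentences are written as words in Polish notation over a finite alphabet.
-- xᵢ is the letter x followed by i strokes.  (As all variables are
-- quantified one by one in the prefix, unary indices are at most
-- as long as the sentence.)  An integer is a marker, an optional minus sign,
-- and the bits of its absolute value, least significant first.
data Symbol : Set where
  `∃ `∀ `∧ `∨ `< `≤ `+ `× `x `y `stroke `# `- `0 `1 : Symbol

encodeBit : Bit → Symbol
encodeBit zero       = `0
encodeBit (suc zero) = `1

encodeℕ : ℕ → List Symbol
encodeℕ k = map encodeBit (proj₁ (toDigits 2 k))

encodeℤ : ℤ → List Symbol
encodeℤ (+ k)    = `# ∷ encodeℕ k
encodeℤ -[1+ k ] = `# ∷ `- ∷ encodeℕ (suc k)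

encodeVar : ∀ {n m} → Var n m → List Symbol
encodeVar (inj₁ i) = `x ∷ replicate (toℕ i) `stroke
encodeVar (inj₂ j) = `y ∷ replicate (toℕ j) `stroke

encodeTerm : ∀ {n m} → Term (Var n m) → List Symbol
encodeTerm (const c) = encodeℤ c
encodeTerm (var v)   = encodeVar v
encodeTerm (s +ᵗ t)  = `+ ∷ encodeTerm s ++ encodeTerm t
encodeTerm (s ×ᵗ t)  = `× ∷ encodeTerm s ++ encodeTerm t

encodeQFF : ∀ {n m} → QFF (Var n m) → List Symbol
encodeQFF (s <ᶠ t) = `< ∷ encodeTerm s ++ encodeTerm t
encodeQFF (s ≤ᶠ t) = `≤ ∷ encodeTerm s ++ encodeTerm t
encodeQFF (φ ∧ᶠ ψ) = `∧ ∷ encodeQFF φ ++ encodeQFF ψ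
encodeQFF (φ ∨ᶠ ψ) = `∨ ∷ encodeQFF φ ++ encodeQFF ψ

encodeΣ₂ : Σ₂ → List Symbol
encodeΣ₂ (∃∀ n m Φ) = replicate n `∃ ++ replicate m `∀ ++ encodeQFF Φ

encodeΣ₂≤ : Σ₂≤ → List Symbol
encodeΣ₂≤ = encodeΣ₂ ∘ Σ₂≤.sentence

-- A bounded sentence is written in its abbreviated form, which is no longer
-- than the sentence it abbreviates.
encodebΣ₂≤ : bΣ₂≤ → List Symbol
encodebΣ₂≤ s = encodeΣ₂ (∃∀ n m matrix)
  where open bΣ₂≤ s

data Move : Set where
  left stay right : Move

-- A two-way infinite tape; all cells beyond the two lists are blank, and
-- the cells before the head are listed nearest first.
record Tape (C : Set) : Set where
  constructor tape
  field
    before : List C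
    head   : C
    after  : List C

-- Deterministic Turing machines with an input tape, an output tape and
-- finitely many further tapes.  The domain of δ is finite when Γ is, so
-- δ is a finite table; δ q cs = nothing means that the machine halts.
module _ (Γ : Set) where

  Cell : ℕ → Set
  Cell g = Maybe (Γ ⊎ Fin g)

  record TuringMachine : Set where
    field
      extraTapes   : ℕ
      extraSymbols : ℕ
      states       : ℕ
      start        : Fin states

    tapes : ℕ
    tapes = suc (suc extraTapes)

    field
      δ : Fin states → Vec (Cell extraSymbols) tapes →
          Maybe (Fin states × Vec (Cell extraSymbols × Move) tapes)

module Run {Γ : Set} (M : TuringMachine Γ) where
  open TuringMachine M

  C : Set
  C = Cell Γ extraSymbols

  blank : C
  blank = nothing

  letter : Γ → C
  letter a = just (inj₁ a)

  move : Move → Tape C → Tape C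
  move stay  t                      = t
  move left  (tape []       h rs)   = tape [] blank (h ∷ rs)
  move left  (tape (l ∷ ls) h rs)   = tape ls l (h ∷ rs)
  move right (tape ls h [])         = tape (h ∷ ls) blank []
  move right (tape ls h (r ∷ rs))   = tape (h ∷ ls) r rs

  act : C × Move → Tape C → Tape C
  act (c , d) (tape ls _ rs) = move d (tape ls c rs)

  record Config : Set where
    constructor config
    field
      state : Fin states
      store : Vec (Tape C) tapes

  next : Config → Maybe (Fin states × Vec (C × Move) tapes)
  next (config q ts) = δ q (Vec.map Tape.head ts)

  Halted : Config → Set
  Halted c = next c ≡ nothing

  step : Config → Config
  step c with next c
  ... | nothing        = c
  ... | just (q , as) = config q (Vec.zipWith act as (Config.store c))

  steps : ℕ → Config → Config
  steps zero    c = c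
  steps (suc k) c = steps k (step c)

  emptyTape : Tape C
  emptyTape = tape [] blank []

  inputTape : List Γ → Tape C
  inputTape []      = emptyTape
  inputTape (a ∷ w) = tape [] (letter a) (map letter w)

  initial : List Γ → Config
  initial w = config start (inputTape w ∷ Vec.replicate _ emptyTape)

  Contains : Tape C → List Γ → Set
  Contains (tape ls h rs) w = ∃[ i ] ∃[ j ]
    ls ʳ++ (h ∷ rs) ≡ replicate i blank ++ map letter w ++ replicate j blank

  outputTape : Config → Tape C
  outputTape c = Vec.head (Vec.tail (Config.store c))

  HaltsWithin : ℕ → List Γ → List Γ → Set
  HaltsWithin b w v = ∃[ k ] (k ℕ.≤ b) ×
    Halted (steps k (initial w)) × Contains (outputTape (steps k (initial w))) v

PolynomialTime : {A B Γ : Set} → (A → List Γ) → (B → List Γ) → (A → B) → Set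
PolynomialTime {A} {Γ = Γ} encodeA encodeB f =
  Σ[ M ∈ TuringMachine Γ ] ∃[ c ] ∃[ d ] ((a : A) →
    Run.HaltsWithin M (c ℕ.* length (encodeA a) ℕ.^ d ℕ.+ c) (encodeA a) (encodeB (f a)))

{-# OPTIONS --safe #-}
module Submission where

-- A formula without strict inequalities defines a closed set, so it holds on the cube [-1,1]ᵐ as
-- soon as it holds on the open cube (-1,1)ᵐ: if it fails at Y, then it fails at (1 - s)Y for all
-- small s > 0.  Hence the guard |Y| > 1 can be replaced by the non-strict ⋁ⱼ 1 ≤ yⱼ², and |X| ≤ 1
-- by ⋀ᵢ xᵢ² ≤ 1.  Nesting both to the right, in Polish notation, inserts one block of letters
-- per variable between the quantifiers and Φ and leaves the rest of the input word unchanged.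

open import Defs
import Algebra.Properties.Ring as RingProperties
import Algebra.Solver.Ring.NaturalCoefficients.Default as SemiringSolver
open import Data.Fin.Base using (Fin; zero; suc; toℕ; fromℕ<)
open import Data.Fin.Properties using (toℕ-fromℕ<; toℕ<n; fromℕ<-toℕ)
import Data.Integer.Base as ℤ
open import Data.List.Base using (List; []; _∷_; _++_; _ʳ++_; length; map; replicate)
open import Data.List.Properties using (++-assoc; ++-identityʳ; ++-ʳ++; ʳ++-ʳ++; map-++; length-++; length-replicate)
open import Data.Maybe.Base using (Maybe; just; nothing)
open import Data.Nat.Base as ℕ using (ℕ; zero; suc)
import Data.Nat.Properties as ℕₚ
open import Data.Nat.Tactic.RingSolver using (solve-∀)
open import Data.Product.Base using (Σ-syntax; ∃-syntax; _×_; _,_; proj₁; proj₂)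
open import Data.Sum.Base using (_⊎_; inj₁; inj₂; [_,_]′)
open import Data.Vec.Base using (Vec; []; _∷_)
open import Data.Vec.Functional using (Vector)
open import Function.Base using (_∘_)
open import Function.Bundles using (_⇔_; mk⇔)
open import Relation.Binary.Bundles using (StrictPartialOrder)
import Relation.Binary.Construct.StrictToNonStrict as StrictToNonStrict
open import Relation.Binary.Definitions using (tri<; tri≈; tri>)
import Relation.Binary.PropositionalEquality as ≡
import Relation.Binary.Reasoning.StrictPartialOrder as StrictPartialOrderReasoning
open import Relation.Binary.Structures using (IsStrictTotalOrder)
open import Relation.Nullary using (¬_; Dec; yes; no; contradiction; _×-dec_; _⊎-dec_)

-- Squaring folds each two-sided bound into one atom with the single constant 1, so every variable
-- costs one block of fixed shape. Indices are unary, so a block is linear in the index of its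
-- variable and the output at most quadratic in the input. The two sentences share their witness X.
-- Closing the matrix weakens it at every point, so only the way back has to vary Y. The obstacle
-- there is disjunction: both disjuncts must fail at a common shrunk point, so failure has to
-- persist for all small s, with explicit thresholds of which the smaller is taken. These come from
-- writing each polynomial along the segment towards 0 as its value at s = 0 plus s times a factor
-- that is bounded for |s| ≤ 1.

1ᵗ : ∀ {V} → Term V
1ᵗ = const ℤ.1ℤ

_² : ∀ {V} → V → Term V
v ² = var v ×ᵗ var v

-- Indices descend from the outside in, the order in which a stack of marks yields them. With Φ
-- itself as the base case, no constant for truth is needed and Φ stays at the end of the word.
boundFirst : ∀ {n m} k → k ℕ.≤ n → QFF (Var n m) → QFF (Var n m)
boundFirst zero    _   Φ = Φ
boundFirst (suc k) k<n Φ = ((inj₁ (fromℕ< k<n) ²) ≤ᶠ 1ᵗ) ∧ᶠ boundFirst k (ℕₚ.<⇒≤ k<n) Φ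

escapeFirst : ∀ {n m} k → k ℕ.≤ m → QFF (Var n m) → QFF (Var n m)
escapeFirst zero    _   Φ = Φ
escapeFirst (suc k) k<m Φ = (1ᵗ ≤ᶠ (inj₂ (fromℕ< k<m) ²)) ∨ᶠ escapeFirst k (ℕₚ.<⇒≤ k<m) Φ

closedMatrix : ∀ {n m} → QFF (Var n m) → QFF (Var n m)
closedMatrix {n} {m} Φ = escapeFirst m ℕₚ.≤-refl (boundFirst n ℕₚ.≤-refl Φ)

boundFirst-strictFree : ∀ {n m} k (k≤n : k ℕ.≤ n) {Φ : QFF (Var n m)} →
  StrictFree Φ → StrictFree (boundFirst k k≤n Φ)
boundFirst-strictFree zero    _   free = free
boundFirst-strictFree (suc k) k<n free = ∧-free (≤-free _ _) (boundFirst-strictFree k _ free)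

escapeFirst-strictFree : ∀ {n m} k (k≤m : k ℕ.≤ m) {Φ : QFF (Var n m)} →
  StrictFree Φ → StrictFree (escapeFirst k k≤m Φ)
escapeFirst-strictFree zero    _   free = free
escapeFirst-strictFree (suc k) k<m free = ∨-free (≤-free _ _) (escapeFirst-strictFree k _ free)

closeCube : bΣ₂≤ → Σ₂≤
closeCube s = record
  { sentence   = ∃∀ n m (closedMatrix matrix)
  ; strictFree = escapeFirst-strictFree m _ (boundFirst-strictFree n _ strictFree)
  }
  where open bΣ₂≤ s

-- A Turing machine that inserts the blocks

module Machine where

  open import Data.Nat.Base using (_+_; _*_; _^_; _≤_; z≤n; s≤s)
  open import Data.Nat.Properties
  open ≡ using (_≡_; refl; sym; trans; cong; cong₂; subst)

  data Block : Set where
    bound escape : Block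

  variableLetter : Block → Symbol
  variableLetter bound  = `x
  variableLetter escape = `y

  encodeVariable : Block → ℕ → List Symbol
  encodeVariable b i = variableLetter b ∷ replicate i `stroke

  -- The blocks read ∧ ≤ × xᵢ xᵢ 1 and ∨ ≤ 1 × yⱼ yⱼ in Polish notation. The constant 1, two letters
  -- long, thus lies behind the variables in the former and before them in the latter.
  blockHead : Block → List Symbol
  blockHead bound  = `∧ ∷ `≤ ∷ `× ∷ []
  blockHead escape = `∨ ∷ `≤ ∷ `# ∷ `1 ∷ `× ∷ []

  blockTail : Block → List Symbol
  blockTail bound  = `# ∷ `1 ∷ []
  blockTail escape = []

  block : Block → ℕ → List Symbol
  block b i = blockHead b ++ encodeVariable b i ++ encodeVariable b i ++ blockTail b

  blocks : Block → ℕ → List Symbol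
  blocks b zero    = []
  blocks b (suc i) = block b i ++ blocks b i

  -- While copying the quantifiers the machine pushes one mark per variable on its third tape.
  -- Popping a mark leaves as many marks of its kind below as the index of the variable, and the
  -- two copies of the variable in its block are written by walking over them to the left and
  -- back.  The states bound₁, …, escape₅ write the fixed letters of the blocks.
  pattern start   = zero
  pattern scan    = suc start
  pattern pop     = suc scan
  pattern copy    = suc pop
  pattern bound₁  = suc copy
  pattern bound₂  = suc bound₁
  pattern bound₃  = suc bound₂
  pattern bound←  = suc bound₃
  pattern bound→  = suc bound←
  pattern bound₄  = suc bound→
  pattern escape₁ = suc bound₄
  pattern escape₂ = suc escape₁
  pattern escape₃ = suc escape₂
  pattern escape₄ = suc escape₃
  pattern escape₅ = suc escape₄
  pattern escape← = suc escape₅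
  pattern escape→ = suc escape←

  pattern lit a = just (inj₁ a)
  pattern blank = nothing

  Transition : Set
  Transition = Maybe (Fin 17 × Vec (Cell Symbol 0 × Move) 3)

  emit : Symbol → Cell Symbol 0 × Move
  emit a = lit a , right

  skip : Cell Symbol 0 → Cell Symbol 0 × Move
  skip c = c , stay

  table : Fin 17 → (i o a : Cell Symbol 0) → Transition
  -- The first cell of the third tape stays blank and serves as the bottom of the stack.
  table start i o a = just (scan , skip i ∷ skip o ∷ (a , right) ∷ [])
  table scan (lit `∃) o a = just (scan , (lit `∃ , right) ∷ emit `∃ ∷ emit `x ∷ [])
  table scan (lit `∀) o a = just (scan , (lit `∀ , right) ∷ emit `∀ ∷ emit `y ∷ [])
  table scan i o a = just (pop , skip i ∷ skip o ∷ (a , left) ∷ [])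
  -- The erased mark leaves the blank at which the walk back to the right will stop.
  table pop i o (lit `x) = just (bound₁ , skip i ∷ emit `∧ ∷ (blank , left) ∷ [])
  table pop i o (lit `y) = just (escape₁ , skip i ∷ emit `∨ ∷ (blank , left) ∷ [])
  table pop i o a = just (copy , skip i ∷ skip o ∷ skip a ∷ [])
  table copy (lit s) o a = just (copy , (lit s , right) ∷ emit s ∷ skip a ∷ [])
  table copy blank o a = nothing
  table bound₁ i o a = just (bound₂ , skip i ∷ emit `≤ ∷ skip a ∷ [])
  table bound₂ i o a = just (bound₃ , skip i ∷ emit `× ∷ skip a ∷ [])
  table bound₃ i o a = just (bound← , skip i ∷ emit `x ∷ skip a ∷ [])
  table bound← i o (lit `x) = just (bound← , skip i ∷ emit `stroke ∷ (lit `x , left) ∷ [])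
  table bound← i o a = just (bound→ , skip i ∷ emit `x ∷ (a , right) ∷ [])
  table bound→ i o (lit `x) = just (bound→ , skip i ∷ emit `stroke ∷ (lit `x , right) ∷ [])
  table bound→ i o a = just (bound₄ , skip i ∷ emit `# ∷ skip a ∷ [])
  table bound₄ i o a = just (pop , skip i ∷ emit `1 ∷ (a , left) ∷ [])
  table escape₁ i o a = just (escape₂ , skip i ∷ emit `≤ ∷ skip a ∷ [])
  table escape₂ i o a = just (escape₃ , skip i ∷ emit `# ∷ skip a ∷ [])
  table escape₃ i o a = just (escape₄ , skip i ∷ emit `1 ∷ skip a ∷ [])
  table escape₄ i o a = just (escape₅ , skip i ∷ emit `× ∷ skip a ∷ [])
  table escape₅ i o a = just (escape← , skip i ∷ emit `y ∷ skip a ∷ [])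
  table escape← i o (lit `y) = just (escape← , skip i ∷ emit `stroke ∷ (lit `y , left) ∷ [])
  table escape← i o a = just (escape→ , skip i ∷ emit `y ∷ (a , right) ∷ [])
  table escape→ i o (lit `y) = just (escape→ , skip i ∷ emit `stroke ∷ (lit `y , right) ∷ [])
  table escape→ i o a = just (pop , skip i ∷ skip o ∷ (a , left) ∷ [])

  machine : TuringMachine Symbol
  machine = record
    { extraTapes   = 1
    ; extraSymbols = 0
    ; states       = 17
    ; start        = start
    ; δ            = λ { q (i ∷ o ∷ a ∷ []) → table q i o a }
    }

  open Run machine hiding (blank)

  -- The lists are the cells on both sides of a boundary, nearest first; the head stands on the
  -- cell just right (resp. left) of it.
  rightward leftward : List C → List C → Tape C
  rightward ls []       = tape ls blank []
  rightward ls (r ∷ rs) = tape ls r rs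
  leftward []       rs  = tape [] blank rs
  leftward (l ∷ ls) rs  = tape ls l rs

  move-right : ∀ ls h rs → move right (tape ls h rs) ≡ rightward (h ∷ ls) rs
  move-right ls h []       = refl
  move-right ls h (r ∷ rs) = refl

  move-left : ∀ ls h rs → move left (tape ls h rs) ≡ leftward ls (h ∷ rs)
  move-left []       h rs = refl
  move-left (l ∷ ls) h rs = refl

  inputTape≡rightward : ∀ w → inputTape w ≡ rightward [] (map letter w)
  inputTape≡rightward []      = refl
  inputTape≡rightward (a ∷ w) = refl

  written : List C → List Symbol → List C
  written o w = map letter w ʳ++ o

  written-++ : ∀ o v w → written (written o v) w ≡ written o (v ++ w)
  written-++ o v w = trans (sym (++-ʳ++ (map letter v))) (cong (_ʳ++ o) (sym (map-++ letter v w)))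

  conf : Fin 17 → Tape C → List C → Tape C → Config
  conf q i o a = config q (i ∷ tape o blank [] ∷ a ∷ [])

  -- A record rather than the bare equation, so that the two configurations can be inferred when
  -- runs are chained.
  infix 3 _⟶[_]_
  record _⟶[_]_ (c : Config) (k : ℕ) (c′ : Config) : Set where
    constructor run
    field steps≡ : steps k c ≡ c′

  steps-+ : ∀ j k c → steps (j + k) c ≡ steps k (steps j c)
  steps-+ zero    k c = refl
  steps-+ (suc j) k c = steps-+ j k (step c)

  infixr 5 _▸_
  _▸_ : ∀ {c c′ c″ j k} → c ⟶[ j ] c′ → c′ ⟶[ k ] c″ → c ⟶[ j + k ] c″
  _▸_ {c} {j = j} {k} (run refl) (run q) = run (trans (steps-+ j k c) q)

  infixl 4 _≡▸_
  _≡▸_ : ∀ {c c′ c″ k} → c ⟶[ k ] c′ → c′ ≡ c″ → c ⟶[ k ] c″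
  r ≡▸ refl = r

  -- Phases of the run

  quantifier : Block → Symbol
  quantifier bound  = `∃
  quantifier escape = `∀

  mark : Block → C
  mark b = letter (variableLetter b)

  replicate-++-∷ : ∀ {A : Set} n {x : A} {xs} → replicate n x ++ x ∷ xs ≡ x ∷ replicate n x ++ xs
  replicate-++-∷ zero        = refl
  replicate-++-∷ (suc n) {x} = cong (x ∷_) (replicate-++-∷ n)

  scan-step : ∀ b ls w o s →
    conf scan (rightward ls (map letter (quantifier b ∷ w))) o (tape s blank [])
      ⟶[ 1 ]
    conf scan (rightward (written ls (quantifier b ∷ [])) (map letter w))
      (written o (quantifier b ∷ [])) (tape (mark b ∷ s) blank [])
  scan-step bound  ls w o s = run (cong (λ t → conf scan t _ _) (move-right ls _ _))
  scan-step escape ls w o s = run (cong (λ t → conf scan t _ _) (move-right ls _ _))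

  scan-prefix : ∀ b n {ls w o s} →
    conf scan (rightward ls (map letter (replicate n (quantifier b) ++ w))) o (tape s blank [])
      ⟶[ n ]
    conf scan (rightward (written ls (replicate n (quantifier b))) (map letter w))
      (written o (replicate n (quantifier b))) (tape (replicate n (mark b) ++ s) blank [])
  scan-prefix b zero = run refl
  scan-prefix b (suc n) =
    scan-step b _ _ _ _ ▸
    (scan-prefix b n ≡▸ cong (λ s → conf scan _ _ (tape s blank [])) (replicate-++-∷ n))

  walk← walk→ : Block → Fin 17
  walk← bound  = bound←
  walk← escape = escape←
  walk→ bound  = bound→
  walk→ escape = escape→

  -- The cells that can lie just below a run of marks of the given block.
  data Stop : Block → C → Set where
    bottom : ∀ {b} → Stop b blank
    other  : Stop escape (mark bound)

  -- The marks give the strokes of the first copy of the variable. The extra step reads the stop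
  -- cell: there the head turns, and the letter of the second copy is written.
  walk-left : ∀ b i {h} → Stop b h → ∀ {t o s r} →
    conf (walk← b) t o (leftward (replicate i (mark b) ++ h ∷ s) r)
      ⟶[ i + 1 ]
    conf (walk→ b) t (written o (replicate i `stroke ++ variableLetter b ∷ []))
      (rightward (h ∷ s) (replicate i (mark b) ++ r))
  walk-left bound  zero bottom = run (cong (conf _ _ _) (move-right _ _ _))
  walk-left escape zero bottom = run (cong (conf _ _ _) (move-right _ _ _))
  walk-left escape zero other  = run (cong (conf _ _ _) (move-right _ _ _))
  walk-left b (suc i) {h} stop {t} {o} {s} {r} =
    step-left b ▸
    (walk-left b i stop ≡▸ cong (λ r′ → conf _ _ _ (rightward (h ∷ s) r′)) (replicate-++-∷ i))
    where
    step-left : ∀ b →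
      conf (walk← b) t o (leftward (replicate (suc i) (mark b) ++ h ∷ s) r)
        ⟶[ 1 ]
      conf (walk← b) t (written o (`stroke ∷ [])) (leftward (replicate i (mark b) ++ h ∷ s) (mark b ∷ r))
    step-left bound  = run (cong (conf _ _ _) (move-left _ _ _))
    step-left escape = run (cong (conf _ _ _) (move-left _ _ _))

  walk-right : ∀ b i {t o s r} →
    conf (walk→ b) t o (rightward s (replicate i (mark b) ++ r))
      ⟶[ i ]
    conf (walk→ b) t (written o (replicate i `stroke)) (rightward (replicate i (mark b) ++ s) r)
  walk-right b zero = run refl
  walk-right b (suc i) {t} {o} {s} {r} =
    step-right b ▸
    (walk-right b i ≡▸ cong (λ s′ → conf _ _ _ (rightward s′ r)) (replicate-++-∷ i))
    where
    step-right : ∀ b →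
      conf (walk→ b) t o (rightward s (replicate (suc i) (mark b) ++ r))
        ⟶[ 1 ]
      conf (walk→ b) t (written o (`stroke ∷ [])) (rightward (mark b ∷ s) (replicate i (mark b) ++ r))
    step-right bound  = run (cong (conf _ _ _) (move-right _ _ _))
    step-right escape = run (cong (conf _ _ _) (move-right _ _ _))

  -- One step per letter, with the first variable letter counted in the head. Leaving an escape
  -- block writes nothing but still costs the step back onto the marks.
  headTime tailTime : Block → ℕ
  headTime bound  = 4
  headTime escape = 6
  tailTime bound  = 2
  tailTime escape = 1

  enter-block : ∀ b {t o s r} →
    conf pop t o (leftward (mark b ∷ s) r)
      ⟶[ headTime b ]
    conf (walk← b) t (written o (blockHead b ++ variableLetter b ∷ [])) (leftward s (blank ∷ r))
  enter-block bound  = run (cong (conf _ _ _) (move-left _ _ _))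
  enter-block escape = run (cong (conf _ _ _) (move-left _ _ _))

  leave-block : ∀ b {t o s r} →
    conf (walk→ b) t o (rightward s (blank ∷ r))
      ⟶[ tailTime b ]
    conf pop t (written o (blockTail b)) (leftward s (blank ∷ r))
  leave-block bound  = run (cong (conf _ _ _) (move-left _ _ _))
  leave-block escape = run (cong (conf _ _ _) (move-left _ _ _))

  blockTime : Block → ℕ → ℕ
  blockTime b i = headTime b + ((i + 1) + (i + tailTime b))

  block-word : ∀ b i o →
    written (written (written (written o (blockHead b ++ variableLetter b ∷ []))
      (replicate i `stroke ++ variableLetter b ∷ [])) (replicate i `stroke)) (blockTail b)
    ≡ written o (block b i)
  block-word b i o
    rewrite written-++ o (blockHead b ++ variableLetter b ∷ []) (replicate i `stroke ++ variableLetter b ∷ [])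
          | written-++ o ((blockHead b ++ variableLetter b ∷ []) ++ replicate i `stroke ++ variableLetter b ∷ []) (replicate i `stroke)
          | written-++ o (((blockHead b ++ variableLetter b ∷ []) ++ replicate i `stroke ++ variableLetter b ∷ []) ++ replicate i `stroke) (blockTail b)
          | ++-assoc (blockHead b) (variableLetter b ∷ []) (replicate i `stroke ++ variableLetter b ∷ [])
          | ++-assoc (blockHead b) (encodeVariable b i ++ variableLetter b ∷ []) (replicate i `stroke)
          | ++-assoc (encodeVariable b i) (variableLetter b ∷ []) (replicate i `stroke)
          | ++-assoc (blockHead b) (encodeVariable b i ++ encodeVariable b i) (blockTail b)
          | ++-assoc (encodeVariable b i) (encodeVariable b i) (blockTail b)
    = refl

  write-block : ∀ b i {h} → Stop b h → ∀ {t o s r} →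
    conf pop t o (leftward (replicate (suc i) (mark b) ++ h ∷ s) r)
      ⟶[ blockTime b i ]
    conf pop t (written o (block b i)) (leftward (replicate i (mark b) ++ h ∷ s) (blank ∷ r))
  write-block b i stop {o = o} =
    enter-block b ▸ walk-left b i stop ▸ walk-right b i ▸ leave-block b
    ≡▸ cong (λ o → conf _ _ o _) (block-word b i o)

  blocksTime : Block → ℕ → ℕ
  blocksTime b zero    = 0
  blocksTime b (suc i) = blockTime b i + blocksTime b i

  write-blocks : ∀ b i {h} → Stop b h → ∀ {t o s r} →
    conf pop t o (leftward (replicate i (mark b) ++ h ∷ s) r)
      ⟶[ blocksTime b i ]
    conf pop t (written o (blocks b i)) (leftward (h ∷ s) (replicate i blank ++ r))
  write-blocks b zero    stop = run refl
  write-blocks b (suc i) {h} stop {t} {o} {s} {r} =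
    write-block b i stop ▸ write-blocks b i stop
    ≡▸ cong₂ (λ o r → conf pop t o (leftward (h ∷ s) r)) (written-++ o (block b i) (blocks b i)) (replicate-++-∷ i)

  copy-rest : ∀ w {ls o a} →
    conf copy (rightward ls (map letter w)) o a
      ⟶[ length w ]
    conf copy (rightward (written ls w) []) (written o w) a
  copy-rest []      = run refl
  copy-rest (x ∷ w) {ls} {o} {a} = copy-step ▸ copy-rest w
    where
    copy-step :
      conf copy (rightward ls (map letter (x ∷ w))) o a
        ⟶[ 1 ]
      conf copy (rightward (letter x ∷ ls) (map letter w)) (letter x ∷ o) a
    copy-step = run (cong (λ t → conf copy t _ _) (move-right _ _ _))

  encode-boundFirst : ∀ {n m} k (k≤n : k ≤ n) (Φ : QFF (Var n m)) →
    encodeQFF (boundFirst k k≤n Φ) ≡ blocks bound k ++ encodeQFF Φ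
  encode-boundFirst zero    _   Φ = refl
  encode-boundFirst (suc k) k<n Φ
    rewrite toℕ-fromℕ< k<n
          | encode-boundFirst k (<⇒≤ k<n) Φ
          | ++-assoc (replicate k `stroke) (encodeVariable bound k) (`# ∷ `1 ∷ [])
          | ++-assoc (block bound k) (blocks bound k) (encodeQFF Φ)
    = refl

  encode-escapeFirst : ∀ {n m} k (k≤m : k ≤ m) (Φ : QFF (Var n m)) →
    encodeQFF (escapeFirst k k≤m Φ) ≡ blocks escape k ++ encodeQFF Φ
  encode-escapeFirst zero    _   Φ = refl
  encode-escapeFirst (suc k) k<m Φ
    rewrite toℕ-fromℕ< k<m
          | encode-escapeFirst k (<⇒≤ k<m) Φ
          | ++-assoc (block escape k) (blocks escape k) (encodeQFF Φ)
          | ++-identityʳ (replicate k `stroke)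
    = refl

  begin-scan : ∀ w →
    initial w ⟶[ 1 ] conf scan (rightward [] (map letter w)) [] (tape (blank ∷ []) blank [])
  begin-scan w = run (cong (λ t → conf scan t [] _) (inputTape≡rightward w))

  -- An encoded formula never begins with a quantifier; the case split exposes its first letter to
  -- `table`.
  end-scan : ∀ {n m} (Φ : QFF (Var n m)) {ls o s} →
    conf scan (rightward ls (map letter (encodeQFF Φ))) o (tape s blank [])
      ⟶[ 1 ]
    conf pop (rightward ls (map letter (encodeQFF Φ))) o (leftward s (blank ∷ []))
  end-scan (_ <ᶠ _) = run (cong (conf _ _ _) (move-left _ _ _))
  end-scan (_ ≤ᶠ _) = run (cong (conf _ _ _) (move-left _ _ _))
  end-scan (_ ∧ᶠ _) = run (cong (conf _ _ _) (move-left _ _ _))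
  end-scan (_ ∨ᶠ _) = run (cong (conf _ _ _) (move-left _ _ _))

  -- Below the marks for Y lies the bottom of the stack if there are no existential variables, and a
  -- mark for X otherwise; hence the split on n.
  write-escapes : ∀ m n {t o r} →
    conf pop t o (leftward (replicate m (mark escape) ++ replicate n (mark bound) ++ blank ∷ []) r)
      ⟶[ blocksTime escape m ]
    conf pop t (written o (blocks escape m))
      (leftward (replicate n (mark bound) ++ blank ∷ []) (replicate m blank ++ r))
  write-escapes m zero    = write-blocks escape m bottom
  write-escapes m (suc n) = write-blocks escape m other

  end-pop : ∀ {t o r} →
    conf pop t o (leftward (blank ∷ []) r) ⟶[ 1 ] conf copy t o (leftward (blank ∷ []) r)
  end-pop = run refl

  runTime : ℕ → ℕ → ℕ → ℕ
  runTime n m l = 1 + (n + (m + (1 + (blocksTime escape m + (blocksTime bound n + (1 + l))))))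

  machine-run : ∀ n m (Φ : QFF (Var n m)) →
    let w = encodeΣ₂ (∃∀ n m Φ) in
    initial w
      ⟶[ runTime n m (length (encodeQFF Φ)) ]
    conf copy (rightward (written [] w) []) (written [] (encodeΣ₂ (∃∀ n m (closedMatrix Φ))))
      (leftward (blank ∷ []) (replicate n blank ++ replicate m blank ++ blank ∷ []))
  machine-run n m Φ =
    begin-scan _
    ▸ scan-prefix bound n
    ▸ scan-prefix escape m
    ▸ end-scan Φ
    ▸ write-escapes m n
    ▸ write-blocks bound n bottom
    ▸ end-pop
    ▸ copy-rest (encodeQFF Φ)
    ≡▸ cong₂ (λ ls o → conf copy (rightward ls []) o _) input output
    where
    ∃s = replicate n `∃
    ∀s = replicate m `∀
    input : written (written (written [] ∃s) ∀s) (encodeQFF Φ) ≡ written [] (∃s ++ ∀s ++ encodeQFF Φ)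
    input = trans (written-++ _ ∀s _) (written-++ [] ∃s _)
    output : written (written (written (written (written [] ∃s) ∀s) (blocks escape m)) (blocks bound n)) (encodeQFF Φ)
           ≡ written [] (∃s ++ ∀s ++ encodeQFF (closedMatrix Φ))
    output rewrite encode-escapeFirst m ≤-refl (boundFirst n ≤-refl Φ) | encode-boundFirst n ≤-refl Φ =
      trans (written-++ _ (blocks bound n) _) (trans (written-++ _ (blocks escape m) _)
        (trans (written-++ _ ∀s _) (written-++ [] ∃s _)))

  -- The quadratic time bound

  blockTime≤ : ∀ b i → blockTime b i ≤ 8 + 2 * i
  blockTime≤ bound  i = ≤-trans (m≤m+n _ 1) (≤-reflexive (lemma i))
    where
    lemma : ∀ i → 4 + ((i + 1) + (i + 2)) + 1 ≡ 8 + 2 * i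
    lemma = solve-∀
  blockTime≤ escape i = ≤-reflexive (lemma i)
    where
    lemma : ∀ i → 6 + ((i + 1) + (i + 1)) ≡ 8 + 2 * i
    lemma = solve-∀

  -- The increment 8(i + 1)² - 8i² = 16i + 8 exceeds the cost 8 + 2i allowed for one block by 14i.
  blocksTime≤ : ∀ b i → blocksTime b i ≤ 8 * i ^ 2
  blocksTime≤ b zero    = z≤n
  blocksTime≤ b (suc i) = begin
    blockTime b i + blocksTime b i    ≤⟨ +-mono-≤ (blockTime≤ b i) (blocksTime≤ b i) ⟩
    8 + 2 * i + 8 * i ^ 2             ≤⟨ m≤m+n _ (14 * i) ⟩
    8 + 2 * i + 8 * i ^ 2 + 14 * i    ≡⟨ lemma i ⟩
    8 * suc i ^ 2                     ∎
    where
    open ≤-Reasoning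
    lemma : ∀ i → 8 + 2 * i + 8 * (i * (i * 1)) + 14 * i ≡ 8 * ((1 + i) * ((1 + i) * 1))
    lemma = solve-∀

  n≤n^2 : ∀ n → n ≤ n ^ 2
  n≤n^2 zero      = z≤n
  n≤n^2 n@(suc _) = ≤-trans (m≤m*n n n) (*-monoʳ-≤ n (≤-reflexive (sym (*-identityʳ n))))

  -- The factor is 8 + 8 for the two kinds of blocks plus 1 for the linear part. The additive
  -- constant 3 is relaxed to 17 because `PolynomialTime` uses one constant in both places.
  runTime≤ : ∀ n m l → runTime n m l ≤ 17 * (n + (m + l)) ^ 2 + 17
  runTime≤ n m l = begin
    runTime n m l
      ≤⟨ s≤s (+-monoʳ-≤ n (+-monoʳ-≤ m (s≤s (+-mono-≤ (blocksTime≤ escape m)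
           (+-monoˡ-≤ (1 + l) (blocksTime≤ bound n)))))) ⟩
    1 + (n + (m + (1 + (8 * m ^ 2 + (8 * n ^ 2 + (1 + l))))))
      ≡⟨ lemma n m l (m ^ 2) (n ^ 2) ⟩
    L + (8 * m ^ 2 + 8 * n ^ 2) + 3
      ≤⟨ +-mono-≤ (+-mono-≤ (n≤n^2 L) (+-mono-≤
           (*-monoʳ-≤ 8 (^-monoˡ-≤ 2 (≤-trans (m≤m+n m l) (m≤n+m (m + l) n))))
           (*-monoʳ-≤ 8 (^-monoˡ-≤ 2 (m≤m+n n (m + l)))))) (m≤m+n 3 14) ⟩
    L ^ 2 + (8 * L ^ 2 + 8 * L ^ 2) + 17
      ≡⟨ lemma′ (L ^ 2) ⟩
    17 * L ^ 2 + 17 ∎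
    where
    open ≤-Reasoning
    L = n + (m + l)
    lemma : ∀ n m l u v → 1 + (n + (m + (1 + (8 * u + (8 * v + (1 + l)))))) ≡ n + (m + l) + (8 * u + 8 * v) + 3
    lemma = solve-∀
    lemma′ : ∀ q → q + (8 * q + 8 * q) + 17 ≡ 17 * q + 17
    lemma′ = solve-∀

  length-encodeΣ₂ : ∀ n m (Φ : QFF (Var n m)) →
    length (encodeΣ₂ (∃∀ n m Φ)) ≡ n + (m + length (encodeQFF Φ))
  length-encodeΣ₂ n m Φ
    rewrite length-++ (replicate n `∃) {replicate m `∀ ++ encodeQFF Φ}
          | length-++ (replicate m `∀) {encodeQFF Φ}
          | length-replicate n {`∃} | length-replicate m {`∀}
    = refl

  closeCube-polynomialTime : PolynomialTime encodebΣ₂≤ encodeΣ₂≤ closeCube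
  closeCube-polynomialTime = machine , 17 , 2 , λ s → halts (bΣ₂≤.n s) (bΣ₂≤.m s) (bΣ₂≤.matrix s)
    where
    halts : ∀ n m (Φ : QFF (Var n m)) → let w = encodeΣ₂ (∃∀ n m Φ) in
      HaltsWithin (17 * length w ^ 2 + 17) w (encodeΣ₂ (∃∀ n m (closedMatrix Φ)))
    halts n m Φ rewrite length-encodeΣ₂ n m Φ =
      runTime n m (length (encodeQFF Φ)) , runTime≤ n m _ ,
      subst (λ c → Halted c × Contains (outputTape c) v) (sym (_⟶[_]_.steps≡ (machine-run n m Φ)))
        -- The machine halts since `copy` reads a blank. On the output tape no blank precedes the
        -- word, and the one behind it is the cell under the head.
        (refl , 0 , 1 , ʳ++-ʳ++ (map letter v))
      where v = encodeΣ₂ (∃∀ n m (closedMatrix Φ))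

-- Ordered-field arithmetic

module OrderedField (ℝ : CompleteOrderedField) where
  open CompleteOrderedField ℝ hiding (zero)
  open IsStrictTotalOrder isStrictTotalOrder using (compare; irrefl; isStrictPartialOrder; _<?_)
    renaming (trans to <-trans)
  open RingProperties ring
  open SemiringSolver commutativeSemiring using (solve; _:+_; _:*_; _:=_)

  strictPartialOrder : StrictPartialOrder _ _ _
  strictPartialOrder = record { isStrictPartialOrder = isStrictPartialOrder }

  open StrictPartialOrderReasoning strictPartialOrder

  _≤?_ : ∀ x y → Dec (x ≤ y)
  _≤?_ = StrictToNonStrict.decidable′ _≈_ _<_ compare

  ≤-refl : ∀ {x} → x ≤ x
  ≤-refl = inj₂ refl

  ≤-trans : ∀ {x y z} → x ≤ y → y ≤ z → x ≤ z
  ≤-trans x≤y y≤z = begin _ ≤⟨ x≤y ⟩ _ ≤⟨ y≤z ⟩ _ ∎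

  ≰⇒> : ∀ {x y} → ¬ (x ≤ y) → y < x
  ≰⇒> {x} {y} x≰y with compare x y
  ... | tri< x<y _ _ = contradiction (inj₁ x<y) x≰y
  ... | tri≈ _ x≈y _ = contradiction (inj₂ x≈y) x≰y
  ... | tri> _ _ y<x = y<x

  <⇒≱ : ∀ {x y} → x < y → ¬ (y ≤ x)
  <⇒≱ {x} x<y y≤x = irrefl refl (begin-strict x <⟨ x<y ⟩ _ ≤⟨ y≤x ⟩ x ∎)

  +-monoʳ-< : ∀ z {x y} → x < y → z + x < z + y
  +-monoʳ-< z {x} {y} x<y = begin-strict
    z + x ≈⟨ +-comm z x ⟩ x + z <⟨ +-mono-< z x<y ⟩ y + z ≈⟨ +-comm y z ⟩ z + y ∎

  +-monoˡ-≤ : ∀ z {x y} → x ≤ y → x + z ≤ y + z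
  +-monoˡ-≤ z (inj₁ x<y) = inj₁ (+-mono-< z x<y)
  +-monoˡ-≤ z (inj₂ x≈y) = inj₂ (+-congʳ x≈y)

  +-monoʳ-≤ : ∀ z {x y} → x ≤ y → z + x ≤ z + y
  +-monoʳ-≤ z (inj₁ x<y) = inj₁ (+-monoʳ-< z x<y)
  +-monoʳ-≤ z (inj₂ x≈y) = inj₂ (+-congˡ x≈y)

  +-mono-≤ : ∀ {x y u v} → x ≤ y → u ≤ v → x + u ≤ y + v
  +-mono-≤ {y = y} {u} x≤y u≤v = ≤-trans (+-monoˡ-≤ u x≤y) (+-monoʳ-≤ y u≤v)

  x<y⇒0<y-x : ∀ {x y} → x < y → 0# < y - x
  x<y⇒0<y-x {x} {y} x<y = begin-strict 0# ≈⟨ -‿inverseʳ x ⟨ x - x <⟨ +-mono-< (- x) x<y ⟩ y - x ∎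

  x+[y-x]≈y : ∀ x y → x + (y - x) ≈ y
  x+[y-x]≈y x y = begin-equality
    x + (y - x) ≈⟨ +-assoc x y (- x) ⟨ x + y - x ≈⟨ xyx⁻¹≈y x y ⟩ y ∎

  0<y-x⇒x<y : ∀ {x y} → 0# < y - x → x < y
  0<y-x⇒x<y {x} {y} 0<y-x = begin-strict
    x ≈⟨ +-identityʳ x ⟨ x + 0# <⟨ +-monoʳ-< x 0<y-x ⟩ x + (y - x) ≈⟨ x+[y-x]≈y x y ⟩ y ∎

  neg-mono-< : ∀ {x y} → x < y → - y < - x
  neg-mono-< {x} {y} x<y = 0<y-x⇒x<y (begin-strict
    0#          <⟨ x<y⇒0<y-x x<y ⟩
    y - x       ≈⟨ +-comm y (- x) ⟩
    - x + y     ≈⟨ +-congˡ (-‿involutive y) ⟨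
    - x - (- y) ∎)

  neg-mono-≤ : ∀ {x y} → x ≤ y → - y ≤ - x
  neg-mono-≤ (inj₁ x<y) = inj₁ (neg-mono-< x<y)
  neg-mono-≤ (inj₂ x≈y) = inj₂ (sym (-‿cong x≈y))

  x≤0⇒0≤-x : ∀ {x} → x ≤ 0# → 0# ≤ - x
  x≤0⇒0≤-x {x} x≤0 = begin 0# ≈⟨ -0#≈0# ⟨ - 0# ≤⟨ neg-mono-≤ x≤0 ⟩ - x ∎

  *-monoʳ-< : ∀ {z x y} → 0# < z → x < y → z * x < z * y
  *-monoʳ-< {z} {x} {y} 0<z x<y = 0<y-x⇒x<y (begin-strict
    0#            <⟨ *-pos 0<z (x<y⇒0<y-x x<y) ⟩
    z * (y - x)   ≈⟨ x[y-z]≈xy-xz z y x ⟩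
    z * y - z * x ∎)

  *-monoʳ-≤ : ∀ {z x y} → 0# ≤ z → x ≤ y → z * x ≤ z * y
  *-monoʳ-≤ {z} {x} {y} (inj₂ 0≈z) _ = inj₂ (begin-equality
    z * x ≈⟨ *-congʳ 0≈z ⟨ 0# * x ≈⟨ zeroˡ x ⟩ 0# ≈⟨ zeroˡ y ⟨ 0# * y ≈⟨ *-congʳ 0≈z ⟩ z * y ∎)
  *-monoʳ-≤ (inj₁ 0<z) (inj₁ x<y) = inj₁ (*-monoʳ-< 0<z x<y)
  *-monoʳ-≤ (inj₁ 0<z) (inj₂ x≈y) = inj₂ (*-congˡ x≈y)

  *-monoˡ-≤ : ∀ {z x y} → 0# ≤ z → x ≤ y → x * z ≤ y * z
  *-monoˡ-≤ {z} {x} {y} 0≤z x≤y = begin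
    x * z ≈⟨ *-comm x z ⟩ z * x ≤⟨ *-monoʳ-≤ 0≤z x≤y ⟩ z * y ≈⟨ *-comm z y ⟩ y * z ∎

  -x*-y≈x*y : ∀ x y → - x * - y ≈ x * y
  -x*-y≈x*y x y = begin-equality
    - x * - y     ≈⟨ -‿distribˡ-* x (- y) ⟨
    - (x * - y)   ≈⟨ -‿cong (-‿distribʳ-* x y) ⟨
    - (- (x * y)) ≈⟨ -‿involutive (x * y) ⟩
    x * y         ∎

  1<x⇒1<x*x : ∀ {x} → 1# < x → 1# < x * x
  1<x⇒1<x*x {x} 1<x = begin-strict
    1#     <⟨ 1<x ⟩
    x      ≈⟨ *-identityʳ x ⟨
    x * 1# <⟨ *-monoʳ-< (<-trans 0<1 1<x) 1<x ⟩
    x * x  ∎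

  -- The relation |x| ≤ b as two inequalities, which add and multiply without computing an absolute
  -- value.
  infix 4 ∣_∣⊑_
  record ∣_∣⊑_ (x b : Carrier) : Set where
    constructor _,_
    field
      upper : x ≤ b
      lower : - x ≤ b

  ⊑-nonneg : ∀ {x b} → ∣ x ∣⊑ b → 0# ≤ b
  ⊑-nonneg {x} {b} (x≤b , -x≤b) with 0# ≤? x
  ... | yes 0≤x = ≤-trans 0≤x x≤b
  ... | no  0≰x = ≤-trans (x≤0⇒0≤-x (inj₁ (≰⇒> 0≰x))) -x≤b

  ⊑-neg : ∀ {x b} → ∣ x ∣⊑ b → ∣ - x ∣⊑ b
  ⊑-neg {x} {b} (x≤b , -x≤b) = -x≤b , (begin - (- x) ≈⟨ -‿involutive x ⟩ x ≤⟨ x≤b ⟩ b ∎)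

  ⊑-+ : ∀ {x y a b} → ∣ x ∣⊑ a → ∣ y ∣⊑ b → ∣ x + y ∣⊑ a + b
  ⊑-+ {x} {y} {a} {b} (x≤a , -x≤a) (y≤b , -y≤b) = +-mono-≤ x≤a y≤b , (begin
    - (x + y) ≈⟨ -‿+-comm x y ⟨ - x - y ≤⟨ +-mono-≤ -x≤a -y≤b ⟩ a + b ∎)

  -- Either x or - x is a nonnegative left factor, and x * y equals - x * - y. So y or - y may be
  -- raised to b first; then b is nonnegative, and the left factor may be raised to a.
  *-≤-⊑ : ∀ {x y a b} → ∣ x ∣⊑ a → ∣ y ∣⊑ b → x * y ≤ a * b
  *-≤-⊑ {x} {y} {a} {b} x⊑a@(x≤a , -x≤a) y⊑b@(y≤b , -y≤b) with 0# ≤? x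
  ... | yes 0≤x = ≤-trans (*-monoʳ-≤ 0≤x y≤b) (*-monoˡ-≤ (⊑-nonneg y⊑b) x≤a)
  ... | no  0≰x = begin
    x * y     ≈⟨ -x*-y≈x*y x y ⟨
    - x * - y ≤⟨ *-monoʳ-≤ (x≤0⇒0≤-x (inj₁ (≰⇒> 0≰x))) -y≤b ⟩
    - x * b   ≤⟨ *-monoˡ-≤ (⊑-nonneg y⊑b) -x≤a ⟩
    a * b     ∎

  ⊑-* : ∀ {x y a b} → ∣ x ∣⊑ a → ∣ y ∣⊑ b → ∣ x * y ∣⊑ a * b
  ⊑-* {x} {y} {a} {b} x⊑a y⊑b = *-≤-⊑ x⊑a y⊑b , (begin
    - (x * y) ≈⟨ -‿distribˡ-* x y ⟩ - x * y ≤⟨ *-≤-⊑ (⊑-neg x⊑a) y⊑b ⟩ a * b ∎)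

  0≤x⇒x⊑x : ∀ {x} → 0# ≤ x → ∣ x ∣⊑ x
  0≤x⇒x⊑x {x} 0≤x = ≤-refl , (begin - x ≤⟨ neg-mono-≤ 0≤x ⟩ - 0# ≈⟨ -0#≈0# ⟩ 0# ≤⟨ 0≤x ⟩ x ∎)

  ∣_∣ : Carrier → Carrier
  ∣ x ∣ with 0# ≤? x
  ... | yes _ = x
  ... | no  _ = - x

  ⊑-abs : ∀ x → ∣ x ∣⊑ ∣ x ∣
  ⊑-abs x with 0# ≤? x
  ... | yes 0≤x = 0≤x⇒x⊑x 0≤x
  ... | no  0≰x = ≤-trans x≤0 (x≤0⇒0≤-x x≤0) , ≤-refl
    where x≤0 = inj₁ (≰⇒> 0≰x)

  positive-inverse : ∀ {x} → 0# < x → ∃[ y ] 0# < y × x * y ≈ 1#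
  positive-inverse {x} 0<x with inverse x (λ x≈0 → irrefl (sym x≈0) 0<x)
  ... | y , xy≈1 with y ≤? 0#
  ...   | no  y≰0 = y , ≰⇒> y≰0 , xy≈1
  ...   | yes y≤0 = contradiction (begin
    1#     ≈⟨ xy≈1 ⟨
    x * y  ≤⟨ *-monoʳ-≤ (inj₁ 0<x) y≤0 ⟩
    x * 0# ≈⟨ zeroʳ x ⟩
    0#     ∎) (<⇒≱ 0<1)

  +-cancelʳ-< : ∀ z {x y} → x + z < y + z → x < y
  +-cancelʳ-< z x+z<y+z = ≰⇒> (λ y≤x → <⇒≱ x+z<y+z (+-monoˡ-≤ z y≤x))

  ⊑1⇒x*x≤1 : ∀ {x} → ∣ x ∣⊑ 1# → x * x ≤ 1#
  ⊑1⇒x*x≤1 {x} x⊑1 = begin x * x ≤⟨ *-≤-⊑ x⊑1 x⊑1 ⟩ 1# * 1# ≈⟨ *-identityʳ 1# ⟩ 1# ∎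

  x*x≤1⇒⊑1 : ∀ {x} → x * x ≤ 1# → ∣ x ∣⊑ 1#
  x*x≤1⇒⊑1 {x} x*x≤1 = x≤1 x*x≤1 , x≤1 (begin - x * - x ≈⟨ -x*-y≈x*y x x ⟩ x * x ≤⟨ x*x≤1 ⟩ 1# ∎)
    where
    x≤1 : ∀ {y} → y * y ≤ 1# → y ≤ 1#
    x≤1 {y} y*y≤1 with y ≤? 1#
    ... | yes y≤1 = y≤1
    ... | no  y≰1 = contradiction y*y≤1 (<⇒≱ (1<x⇒1<x*x (≰⇒> y≰1)))

  -- The factor r = 1 - s lies in [0,1), whence (ry)² ≤ r² ≤ r < 1. So a shrunk point of the cube
  -- satisfies none of the escape atoms.
  shrunk-square<1 : ∀ {s y} → 0# < s → s ≤ 1# → ∣ y ∣⊑ 1# →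
    ((1# - s) * y) * ((1# - s) * y) < 1#
  shrunk-square<1 {s} {y} 0<s s≤1 y⊑1 = begin-strict
    (r * y) * (r * y)   ≤⟨ *-≤-⊑ ry⊑r1 ry⊑r1 ⟩
    (r * 1#) * (r * 1#) ≈⟨ *-cong (*-identityʳ r) (*-identityʳ r) ⟩
    r * r               ≤⟨ *-monoʳ-≤ 0≤r (inj₁ r<1) ⟩
    r * 1#              ≈⟨ *-identityʳ r ⟩
    r                   <⟨ r<1 ⟩
    1#                  ∎
    where
    r = 1# - s
    0≤r : 0# ≤ r
    0≤r = begin 0# ≈⟨ -‿inverseʳ s ⟨ s - s ≤⟨ +-monoˡ-≤ (- s) s≤1 ⟩ r ∎
    r<1 : r < 1#
    r<1 = begin-strict
      1# - s  <⟨ +-monoʳ-< 1# (neg-mono-< 0<s) ⟩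
      1# - 0# ≈⟨ +-congˡ -0#≈0# ⟩
      1# + 0# ≈⟨ +-identityʳ 1# ⟩
      1#      ∎
    ry⊑r1 = ⊑-* (0≤x⇒x⊑x 0≤r) y⊑1

  -- First-order expansions at 0

  record Expansion (f : Carrier → Carrier) (c : Carrier) : Set where
    field
      slope   : Carrier → Carrier
      rate    : Carrier
      expand  : ∀ s → f s ≈ c + s * slope s
      bounded : ∀ {s} → ∣ s ∣⊑ 1# → ∣ slope s ∣⊑ rate

  constant-expansion : ∀ c → Expansion (λ _ → c) c
  constant-expansion c = record
    { slope   = λ _ → 0#
    ; rate    = ∣ 0# ∣
    ; expand  = λ s → sym (trans (+-congˡ (zeroʳ s)) (+-identityʳ c))
    ; bounded = λ _ → ⊑-abs 0#
    }

  shrink-expansion : ∀ y → Expansion (λ s → (1# - s) * y) y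
  shrink-expansion y = record
    { slope   = λ _ → - y
    ; rate    = ∣ - y ∣
    ; expand  = λ s → begin-equality
        (1# - s) * y       ≈⟨ [y-z]x≈yx-zx y 1# s ⟩
        1# * y - s * y     ≈⟨ +-cong (*-identityˡ y) (-‿distribʳ-* s y) ⟩
        y + s * - y        ∎
    ; bounded = λ _ → ⊑-abs (- y)
    }

  +-expansion : ∀ {f g c d} → Expansion f c → Expansion g d → Expansion (λ s → f s + g s) (c + d)
  +-expansion {c = c} {d} F G = record
    { slope   = λ s → F.slope s + G.slope s
    ; rate    = F.rate + G.rate
    ; expand  = λ s → trans (+-cong (F.expand s) (G.expand s))
        (solve 5 (λ c d s p q → (c :+ s :* p) :+ (d :+ s :* q) := (c :+ d) :+ s :* (p :+ q)) refl
          c d s (F.slope s) (G.slope s))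
    ; bounded = λ s⊑1 → ⊑-+ (F.bounded s⊑1) (G.bounded s⊑1)
    }
    where
    module F = Expansion F
    module G = Expansion G

  -- Expanding (c + sp)(d + sq) leaves a factor s inside the new slope. The restriction of `bounded`
  -- to |s| ≤ 1 is what keeps that term under a fixed rate.
  *-expansion : ∀ {f g c d} → Expansion f c → Expansion g d → Expansion (λ s → f s * g s) (c * d)
  *-expansion {c = c} {d} F G = record
    { slope   = λ s → (c * G.slope s + F.slope s * d) + s * (F.slope s * G.slope s)
    ; rate    = (∣ c ∣ * G.rate + F.rate * ∣ d ∣) + 1# * (F.rate * G.rate)
    ; expand  = λ s → trans (*-cong (F.expand s) (G.expand s))
        (solve 5 (λ c d s p q → (c :+ s :* p) :* (d :+ s :* q) :=
          (c :* d) :+ s :* ((c :* q :+ p :* d) :+ s :* (p :* q))) refl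
          c d s (F.slope s) (G.slope s))
    ; bounded = λ s⊑1 → let p = F.bounded s⊑1; q = G.bounded s⊑1 in
        ⊑-+ (⊑-+ (⊑-* (⊑-abs c) q) (⊑-* p (⊑-abs d))) (⊑-* s⊑1 (⊑-* p q))
    }
    where
    module F = Expansion F
    module G = Expansion G

  -- Demanding P on a whole interval makes the notion stable under intersection. The bound `δ ≤ 1#`
  -- keeps the shrinking factor 1 - δ nonnegative.
  NearZero : (Carrier → Set) → Set
  NearZero P = ∃[ δ ] 0# < δ × δ ≤ 1# × (∀ s → 0# < s → s ≤ δ → P s)

  nearZero-∩ : ∀ {P Q} → NearZero P → NearZero Q → NearZero (λ s → P s × Q s)
  nearZero-∩ (δ , 0<δ , δ≤1 , P) (ε , 0<ε , ε≤1 , Q) with δ ≤? ε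
  ... | yes δ≤ε = δ , 0<δ , δ≤1 , λ s 0<s s≤δ → P s 0<s s≤δ , Q s 0<s (≤-trans s≤δ δ≤ε)
  ... | no  δ≰ε = ε , 0<ε , ε≤1 , λ s 0<s s≤ε → P s 0<s (≤-trans s≤ε (inj₁ (≰⇒> δ≰ε))) , Q s 0<s s≤ε

  nearZero-map : ∀ {P Q : Carrier → Set} → (∀ s → P s → Q s) → NearZero P → NearZero Q
  nearZero-map P⊆Q (δ , 0<δ , δ≤1 , P) = δ , 0<δ , δ≤1 , λ s 0<s s≤δ → P⊆Q s (P s 0<s s≤δ)

  -- If K is the sum of the rates and e = d − c, then δ = e / (K + e) works.
  nearZero-< : ∀ {f g c d} → Expansion f c → Expansion g d → c < d → NearZero (λ s → f s < g s)
  nearZero-< {f} {g} {c} {d} F G c<d = δ , *-pos 0<e 0<y , δ≤1 , near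
    where
    module F = Expansion F
    module G = Expansion G
    K = F.rate + G.rate
    e = d - c
    -- Adding e makes M positive even if K is 0 and gives e / M ≤ 1; the extra term s * e makes the
    -- final estimate strict.
    M = K + e
    ⊑1 = 0≤x⇒x⊑x (inj₁ 0<1)
    0<e = x<y⇒0<y-x c<d
    0≤K : 0# ≤ K
    0≤K = ⊑-nonneg (⊑-+ (F.bounded ⊑1) (G.bounded ⊑1))
    0<M : 0# < M
    0<M = begin-strict 0# <⟨ 0<e ⟩ e ≈⟨ +-identityˡ e ⟨ 0# + e ≤⟨ +-monoˡ-≤ e 0≤K ⟩ M ∎
    M⁻¹ = positive-inverse 0<M
    y = proj₁ M⁻¹
    0<y = proj₁ (proj₂ M⁻¹)
    My≈1 = proj₂ (proj₂ M⁻¹)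
    δ = e * y
    δ≤1 : δ ≤ 1#
    δ≤1 = begin
      e * y        ≈⟨ *-congʳ (+-identityˡ e) ⟨
      (0# + e) * y ≤⟨ *-monoˡ-≤ (inj₁ 0<y) (+-monoˡ-≤ e 0≤K) ⟩
      M * y        ≈⟨ My≈1 ⟩
      1#           ∎
    near : ∀ s → 0# < s → s ≤ δ → f s < g s
    near s 0<s s≤δ = +-cancelʳ-< (s * G.rate) (begin-strict
      f s + s * G.rate                         ≈⟨ +-congʳ (F.expand s) ⟩
      (c + s * F.slope s) + s * G.rate         ≤⟨ +-monoˡ-≤ _ (+-monoʳ-≤ c (*-monoʳ-≤ (inj₁ 0<s) (∣_∣⊑_.upper (F.bounded s⊑1)))) ⟩
      (c + s * F.rate) + s * G.rate            ≈⟨ +-identityʳ _ ⟨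
      (c + s * F.rate) + s * G.rate + 0#       <⟨ +-monoʳ-< _ (*-pos 0<s 0<e) ⟩
      (c + s * F.rate) + s * G.rate + s * e    ≈⟨ solve 5 (λ c s p q e → ((c :+ s :* p) :+ s :* q) :+ s :* e :=
                                                    c :+ ((p :+ q) :+ e) :* s) refl c s F.rate G.rate e ⟩
      c + M * s                                ≤⟨ +-monoʳ-≤ c (*-monoʳ-≤ (inj₁ 0<M) s≤δ) ⟩
      c + M * (e * y)                          ≈⟨ +-congˡ (trans (solve 3 (λ M e y → M :* (e :* y) := e :* (M :* y)) refl M e y)
                                                    (trans (*-congˡ My≈1) (*-identityʳ e))) ⟩
      c + e                                    ≈⟨ x+[y-x]≈y c d ⟩
      d                                        ≈⟨ +-identityʳ d ⟨
      d + 0#                                   ≈⟨ +-congˡ (-‿inverseʳ (s * G.slope s)) ⟨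
      d + (s * G.slope s - s * G.slope s)      ≈⟨ +-assoc d _ _ ⟨
      (d + s * G.slope s) - s * G.slope s      ≈⟨ +-cong (sym (G.expand s)) (-‿distribʳ-* s (G.slope s)) ⟩
      g s + s * - G.slope s                    ≤⟨ +-monoʳ-≤ (g s) (*-monoʳ-≤ (inj₁ 0<s) (∣_∣⊑_.lower (G.bounded s⊑1))) ⟩
      g s + s * G.rate                         ∎)
      where
      s⊑1 : ∣ s ∣⊑ 1#
      s⊑1 = ≤-trans s≤δ δ≤1 ,
        ≤-trans (∣_∣⊑_.lower (0≤x⇒x⊑x (inj₁ 0<s))) (≤-trans s≤δ δ≤1)

  -- Truth of formulas and persistence of failure

  open Semantics ℝ

  -- Trichotomy decides the atoms. This licenses the case distinctions on truth at a point below.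
  ⟦⟧-dec : ∀ {V} (φ : QFF V) ρ → Dec (⟦ φ ⟧ᶠ ρ)
  ⟦⟧-dec (s <ᶠ t) ρ = ⟦ s ⟧ᵗ ρ <? ⟦ t ⟧ᵗ ρ
  ⟦⟧-dec (s ≤ᶠ t) ρ = ⟦ s ⟧ᵗ ρ ≤? ⟦ t ⟧ᵗ ρ
  ⟦⟧-dec (φ ∧ᶠ ψ) ρ = ⟦⟧-dec φ ρ ×-dec ⟦⟧-dec ψ ρ
  ⟦⟧-dec (φ ∨ᶠ ψ) ρ = ⟦⟧-dec φ ρ ⊎-dec ⟦⟧-dec ψ ρ

  ¬ᶠ-complete : ∀ {V} (φ : QFF V) {ρ} → ¬ ⟦ φ ⟧ᶠ ρ → ⟦ ¬ᶠ φ ⟧ᶠ ρ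
  ¬ᶠ-complete (s <ᶠ t) {ρ} ¬s<t with ⟦ t ⟧ᵗ ρ ≤? ⟦ s ⟧ᵗ ρ
  ... | yes t≤s = t≤s
  ... | no  t≰s = contradiction (≰⇒> t≰s) ¬s<t
  ¬ᶠ-complete (s ≤ᶠ t) ¬s≤t = ≰⇒> ¬s≤t
  ¬ᶠ-complete (φ ∧ᶠ ψ) {ρ} ¬φψ with ⟦⟧-dec φ ρ
  ... | yes p = inj₂ (¬ᶠ-complete ψ (λ q → ¬φψ (p , q)))
  ... | no ¬p = inj₁ (¬ᶠ-complete φ ¬p)
  ¬ᶠ-complete (φ ∨ᶠ ψ) ¬φψ = ¬ᶠ-complete φ (¬φψ ∘ inj₁) , ¬ᶠ-complete ψ (¬φψ ∘ inj₂)

  ¬ᶠ-sound : ∀ {V} (φ : QFF V) {ρ} → ⟦ ¬ᶠ φ ⟧ᶠ ρ → ¬ ⟦ φ ⟧ᶠ ρ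
  ¬ᶠ-sound (s <ᶠ t) t≤s s<t = <⇒≱ s<t t≤s
  ¬ᶠ-sound (s ≤ᶠ t) t<s s≤t = <⇒≱ t<s s≤t
  ¬ᶠ-sound (φ ∧ᶠ ψ) (inj₁ ¬p) (p , _) = ¬ᶠ-sound φ ¬p p
  ¬ᶠ-sound (φ ∧ᶠ ψ) (inj₂ ¬q) (_ , q) = ¬ᶠ-sound ψ ¬q q
  ¬ᶠ-sound (φ ∨ᶠ ψ) (¬p , ¬q) (inj₁ p) = ¬ᶠ-sound φ ¬p p
  ¬ᶠ-sound (φ ∨ᶠ ψ) (¬p , ¬q) (inj₂ q) = ¬ᶠ-sound ψ ¬q q

  module _ {V : Set} {path : Carrier → V → Carrier} {ρ : V → Carrier}
           (path→ρ : ∀ v → Expansion (λ s → path s v) (ρ v)) where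

    term-expansion : ∀ t → Expansion (λ s → ⟦ t ⟧ᵗ (path s)) (⟦ t ⟧ᵗ ρ)
    term-expansion (const c) = constant-expansion (fromℤ c)
    term-expansion (var v)   = path→ρ v
    term-expansion (s +ᵗ t)  = +-expansion (term-expansion s) (term-expansion t)
    term-expansion (s ×ᵗ t)  = *-expansion (term-expansion s) (term-expansion t)

    -- A failed atom s ≤ t is a strict inequality t < s, which persists. For a conjunction one
    -- conjunct failing at ρ is selected; for a disjunction the two intervals are intersected.
    failure-nearZero : ∀ {φ} → StrictFree φ → ¬ ⟦ φ ⟧ᶠ ρ → NearZero (λ s → ¬ ⟦ φ ⟧ᶠ (path s))
    failure-nearZero (≤-free s t) s≰t =
      nearZero-map (λ _ → <⇒≱) (nearZero-< (term-expansion t) (term-expansion s) (≰⇒> s≰t))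
    failure-nearZero (∧-free {φ} {ψ} free free′) ¬φψ with ⟦⟧-dec φ ρ
    ... | yes p = nearZero-map (λ _ → _∘ proj₂) (failure-nearZero free′ (λ q → ¬φψ (p , q)))
    ... | no ¬p = nearZero-map (λ _ → _∘ proj₁) (failure-nearZero free ¬p)
    failure-nearZero (∨-free free free′) ¬φψ =
      nearZero-map (λ _ → λ (¬p , ¬q) → [ ¬p , ¬q ]′)
        (nearZero-∩ (failure-nearZero free (¬φψ ∘ inj₁)) (failure-nearZero free′ (¬φψ ∘ inj₂)))

  module _ {n m} {Φ : QFF (Var n m)} {ρ : Var n m → Carrier} where

    boundFirst-sound : ∀ k k≤n → ⟦ boundFirst k k≤n Φ ⟧ᶠ ρ →
      (∀ i → toℕ i ℕ.< k → ⟦ (inj₁ i ²) ≤ᶠ 1ᵗ ⟧ᶠ ρ) × ⟦ Φ ⟧ᶠ ρ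
    boundFirst-sound zero    _   φ = (λ _ ()) , φ
    boundFirst-sound (suc k) k<n (x²≤1 , φ) with boundFirst-sound k _ φ
    ... | below , φ′ = all , φ′
      where
      all : ∀ i → toℕ i ℕ.< suc k → ⟦ (inj₁ i ²) ≤ᶠ 1ᵗ ⟧ᶠ ρ
      all i i<1+k with ℕₚ.m<1+n⇒m<n∨m≡n i<1+k
      ... | inj₁ i<k = below i i<k
      ... | inj₂ ≡.refl = ≡.subst (λ j → ⟦ (inj₁ j ²) ≤ᶠ 1ᵗ ⟧ᶠ ρ) (fromℕ<-toℕ i k<n) x²≤1

    boundFirst-complete : ∀ k k≤n → (∀ i → ⟦ (inj₁ i ²) ≤ᶠ 1ᵗ ⟧ᶠ ρ) → ⟦ Φ ⟧ᶠ ρ → ⟦ boundFirst k k≤n Φ ⟧ᶠ ρ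
    boundFirst-complete zero    _   x²≤1 φ = φ
    boundFirst-complete (suc k) k<n x²≤1 φ = x²≤1 _ , boundFirst-complete k _ x²≤1 φ

    escapeFirst-sound : ∀ k k≤m → ⟦ escapeFirst k k≤m Φ ⟧ᶠ ρ →
      (∃[ j ] ⟦ 1ᵗ ≤ᶠ (inj₂ j ²) ⟧ᶠ ρ) ⊎ ⟦ Φ ⟧ᶠ ρ
    escapeFirst-sound zero    _   φ           = inj₂ φ
    escapeFirst-sound (suc k) k<m (inj₁ 1≤y²) = inj₁ (_ , 1≤y²)
    escapeFirst-sound (suc k) k<m (inj₂ φ)    = escapeFirst-sound k _ φ

    escapeFirst-complete : ∀ k k≤m → ⟦ Φ ⟧ᶠ ρ → ⟦ escapeFirst k k≤m Φ ⟧ᶠ ρ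
    escapeFirst-complete zero    _ φ = φ
    escapeFirst-complete (suc k) _ φ = inj₂ (escapeFirst-complete k _ φ)

    escapeFirst-escape : ∀ k k≤m j → toℕ j ℕ.< k → ⟦ 1ᵗ ≤ᶠ (inj₂ j ²) ⟧ᶠ ρ → ⟦ escapeFirst k k≤m Φ ⟧ᶠ ρ
    escapeFirst-escape (suc k) k<m j j<1+k 1≤y² with ℕₚ.m<1+n⇒m<n∨m≡n j<1+k
    ... | inj₁ j<k    = inj₂ (escapeFirst-escape k _ j j<k 1≤y²)
    ... | inj₂ ≡.refl = inj₁ (≡.subst (λ i → ⟦ 1ᵗ ≤ᶠ (inj₂ i ²) ⟧ᶠ ρ) (≡.sym (fromℕ<-toℕ j k<m)) 1≤y²)

  -- The literal 1 unfolds to `1# + 0#`.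
  fromℤ-1 : fromℤ ℤ.1ℤ ≈ 1#
  fromℤ-1 = +-identityʳ 1#

  -1ᵗ≈-1 : ∀ {V} {ρ : V → Carrier} → ⟦ -ᵗ 1ᵗ ⟧ᵗ ρ ≈ - 1#
  -1ᵗ≈-1 = trans (*-cong (-‿cong (+-identityʳ 1#)) fromℤ-1) (*-identityʳ (- 1#))

  cube-sound : ∀ {V k} {Z : Vector V k} {ρ} → ⟦ ∣ Z ∣≤ 1ᵗ ⟧ᶠ ρ → ∀ j → ∣ ρ (Z j) ∣⊑ 1#
  cube-sound {Z = Z} {ρ} ((-1≤z , z≤1) , _) zero = (begin z ≤⟨ z≤1 ⟩ fromℤ ℤ.1ℤ ≈⟨ fromℤ-1 ⟩ 1# ∎) ,
    (begin - z ≤⟨ neg-mono-≤ -1≤z ⟩ - (⟦ -ᵗ 1ᵗ ⟧ᵗ ρ) ≈⟨ -‿cong (-1ᵗ≈-1 {ρ = ρ}) ⟩ - (- 1#) ≈⟨ -‿involutive 1# ⟩ 1# ∎)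
    where z = ρ (Z zero)
  cube-sound (_ , rest) (suc j) = cube-sound rest j

  cube-complete : ∀ {V k} {Z : Vector V k} {ρ} → (∀ j → ∣ ρ (Z j) ∣⊑ 1#) → ⟦ ∣ Z ∣≤ 1ᵗ ⟧ᶠ ρ
  cube-complete {k = zero}          _   = ≤-refl
  cube-complete {k = suc k} {Z} {ρ} Z⊑1 with Z⊑1 zero
  ... | z≤1 , -z≤1 = ((begin ⟦ -ᵗ 1ᵗ ⟧ᵗ ρ ≈⟨ -1ᵗ≈-1 {ρ = ρ} ⟩ - 1# ≤⟨ neg-mono-≤ -z≤1 ⟩ - (- z) ≈⟨ -‿involutive z ⟩ z ∎) ,
      (begin z ≤⟨ z≤1 ⟩ 1# ≈⟨ fromℤ-1 ⟨ fromℤ ℤ.1ℤ ∎)) , cube-complete (Z⊑1 ∘ suc)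
    where z = ρ (Z zero)

  -- Equivalence of the two sentences

  boxY : ∀ n m → QFF (Var n m)
  boxY n m = ∣_∣≤_ {k = m} inj₂ 1ᵗ

  -- If |Y| > 1 and the closed matrix failed, all its escape atoms would fail. Then every yⱼ² < 1,
  -- which puts Y into the cube.
  closedMatrix-complete : ∀ (s : bΣ₂≤) ρ →
    ⟦ Σ₂.matrix (unabbreviate s) ⟧ᶠ ρ → ⟦ closedMatrix (bΣ₂≤.matrix s) ⟧ᶠ ρ
  closedMatrix-complete s ρ (inj₂ (X⊑1 , φ)) =
    escapeFirst-complete m _ (boundFirst-complete n _ x²≤1 φ)
    where
    open bΣ₂≤ s
    x²≤1 : ∀ i → ⟦ (inj₁ i ²) ≤ᶠ 1ᵗ ⟧ᶠ ρ
    x²≤1 i = begin _ ≤⟨ ⊑1⇒x*x≤1 (cube-sound {Z = inj₁} X⊑1 i) ⟩ 1# ≈⟨ fromℤ-1 ⟨ fromℤ ℤ.1ℤ ∎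
  closedMatrix-complete s ρ (inj₁ Y⋢1) with ⟦⟧-dec (closedMatrix (bΣ₂≤.matrix s)) ρ
  ... | yes φ = φ
  ... | no ¬φ = contradiction (cube-complete {Z = inj₂} {ρ} y⊑1) (¬ᶠ-sound (boxY n m) Y⋢1)
    where
    open bΣ₂≤ s
    y⊑1 : ∀ j → ∣ ρ (inj₂ j) ∣⊑ 1#
    y⊑1 j = x*x≤1⇒⊑1 (begin
      _           <⟨ ≰⇒> (λ 1≤y² → ¬φ (escapeFirst-escape m _ j (toℕ<n j) 1≤y²)) ⟩
      fromℤ ℤ.1ℤ ≈⟨ fromℤ-1 ⟩
      1#          ∎)

  closedMatrix-inside : ∀ {n m} {Φ : QFF (Var n m)} {ρ} → (∀ j → ρ (inj₂ j) * ρ (inj₂ j) < 1#) →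
    ⟦ closedMatrix Φ ⟧ᶠ ρ → (∀ i → ∣ ρ (inj₁ i) ∣⊑ 1#) × ⟦ Φ ⟧ᶠ ρ
  closedMatrix-inside {n} {m} {Φ} {ρ} y²<1 holds with escapeFirst-sound m _ holds
  ... | inj₁ (j , 1≤y²) = contradiction
    (begin 1# ≈⟨ fromℤ-1 ⟨ fromℤ ℤ.1ℤ ≤⟨ 1≤y² ⟩ _ ∎) (<⇒≱ (y²<1 j))
  ... | inj₂ holds′ with boundFirst-sound n _ holds′
  ...   | x²≤1 , φ = (λ i → x*x≤1⇒⊑1 (begin _ ≤⟨ x²≤1 i (toℕ<n i) ⟩ fromℤ ℤ.1ℤ ≈⟨ fromℤ-1 ⟩ 1# ∎)) , φ

  -- Not a pointwise implication: for Y in the cube the hypothesis is used at other points, since on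
  -- the boundary of the cube an escape atom may hold.
  closedMatrix-sound : ∀ (s : bΣ₂≤) X → let open bΣ₂≤ s in
    (∀ (Y : Vector Carrier m) → ⟦ closedMatrix matrix ⟧ᶠ [ X , Y ]′) →
    ∀ Y → ⟦ Σ₂.matrix (unabbreviate s) ⟧ᶠ [ X , Y ]′
  closedMatrix-sound s X holds Y
    with ⟦⟧-dec (boxY (bΣ₂≤.n s) (bΣ₂≤.m s)) [ X , Y ]′ | ⟦⟧-dec (bΣ₂≤.matrix s) [ X , Y ]′
  ... | no Y⋢1  | _     = inj₁ (¬ᶠ-complete (boxY (bΣ₂≤.n s) (bΣ₂≤.m s)) Y⋢1)
  ... | yes _   | yes φ = inj₂ (cube-complete {Z = inj₁} X⊑1 , φ)
    where
    X⊑1 : ∀ i → ∣ X i ∣⊑ 1#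
    -- The bound on X does not mention Y, so it can be read off at Y = 0, where no escape atom
    -- holds.
    X⊑1 = proj₁ (closedMatrix-inside {Φ = bΣ₂≤.matrix s} {[ X , (λ _ → 0#) ]′}
      (λ _ → begin-strict 0# * 0# ≈⟨ zeroˡ 0# ⟩ 0# <⟨ 0<1 ⟩ 1# ∎) (holds (λ _ → 0#)))
  ... | yes Y⊑1 | no ¬φ =
    -- The threshold δ itself serves as the amount of shrinking: Φ fails there, yet the point is
    -- strictly inside the cube.
    contradiction (proj₂ (closedMatrix-inside inside (holds (shrink δ)))) (fails δ 0<δ ≤-refl)
    where
    open bΣ₂≤ s
    shrink : Carrier → Vector Carrier m
    shrink s j = (1# - s) * Y j
    path→XY : ∀ v → Expansion (λ s → [ X , shrink s ]′ v) ([ X , Y ]′ v)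
    path→XY (inj₁ i) = constant-expansion (X i)
    path→XY (inj₂ j) = shrink-expansion (Y j)
    failure = failure-nearZero path→XY strictFree ¬φ
    δ = proj₁ failure
    0<δ = proj₁ (proj₂ failure)
    fails = proj₂ (proj₂ (proj₂ failure))
    inside : ∀ j → shrink δ j * shrink δ j < 1#
    inside j = shrunk-square<1 0<δ (proj₁ (proj₂ (proj₂ failure))) (cube-sound {Z = inj₂} Y⊑1 j)

  closeCube-equivalent : ∀ s → (ℝ ⊨ unabbreviate s) ⇔ (ℝ ⊨ Σ₂≤.sentence (closeCube s))
  closeCube-equivalent s = mk⇔
    (λ (X , holds) → X , λ Y → closedMatrix-complete s [ X , Y ]′ (holds Y))
    (λ (X , holds) → X , closedMatrix-sound s X holds)

mainTheorem9 : Σ[ f ∈ (bΣ₂≤ → Σ₂≤) ]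
    PolynomialTime encodebΣ₂≤ encodeΣ₂≤ f
    × ((ℝ : CompleteOrderedField) (s : bΣ₂≤) →
    (ℝ ⊨ unabbreviate s) ⇔ (ℝ ⊨ Σ₂≤.sentence (f s)))
mainTheorem9 = closeCube , Machine.closeCube-polynomialTime , OrderedField.closeCube-equivalent
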